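{- Let $\gamma$ be an infinite countable ordinal. Then the class $\mathcal{L}_{\prec\boldsymbol{\gamma}}=\{L: L\prec\boldsymbol{\gamma}\}$ is ccs if and only if $\gamma$ is either an (additively) indecomposable ordinal, or the successor of an indecomposable ordinal.
   Context: $L\preceq L'$ means there is an embedding $f:L\to L'$ of linear orders, i.e. $x\le_L y\iff f(x)\le_{L'}f(y)$; $L\prec L'$ means $L\preceq L'$ and $L'\not\preceq L$. $\boldsymbol{\gamma}$ is a well-order of order type $\gamma$. In $\mathcal{L}_{\prec\boldsymbol{\gamma}}$, $L$ ranges over nonempty linear orders (up to isomorphism), so this is the class of nonempty well-orders of order type $<\gamma$. A nonzero ordinal $\gamma$ is (additively) indecomposable if $\alpha+\beta<\gamma$ for all $\alpha,\beta<\gamma$. A subset $I$ of a linear order $L$ is convex if $x\le_L y\le_L z$ and $x,z\in I$ imply $y\in I$. For $A,B\subseteq L$ write $A\le_L B$ if $a\le_L b$ for all $a\in A$, $b\in B$. A class $\mathcal{L}$ of linear orders closed downward under $\preceq$ is ccs (closed under convex sums) if for all $K,K'\in\mathcal{L}$ and every family $(K'_k)_{k\in K}$ of nonempty convex subsets of $K'$ such that $k_0<_K k_1\Rightarrow K'_{k_0}\le_{K'}K'_{k_1}$ for all $k_0,k_1\in K$, we have $\sum_{k\in K}K'_k\in\mathcal{L}$, where $\sum_{k\in K}K'_k=\{(x,k): k\in K, x\in K'_k\}$ ordered antilexicographically. -}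

module Defs where

open import Data.Fin.Base using (Fin)
open import Data.Nat.Base using (ℕ)
open import Data.Product.Base using (Σ-syntax; ∃-syntax; _×_; _,_; proj₁; swap)
open import Data.Product.Relation.Binary.Lex.NonStrict using (×-decTotalOrder)
open import Data.Sum.Relation.Binary.LeftOrder
  using (_⊎-<_; ₁∼₂; ₁∼₁; ₂∼₂; ⊎-<-decTotalOrder; ⊎-<-wellFounded)
open import Data.Sum.Relation.Binary.Pointwise using (inj₁; inj₂)
import Data.Unit.Properties as Unit
open import Function.Base using (_∘_)
open import Function.Bundles using (_⇔_; Bijection; Injection)
open import Induction.WellFounded using (WellFounded; acc; module Subrelation)
open import Level using (0ℓ)
open import Relation.Binary.Bundles using (DecTotalOrder; Setoid)
open import Relation.Binary.Core using (_⇒_)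
import Relation.Binary.Construct.On as On
open import Relation.Binary.Morphism.Structures using (IsOrderIsomorphism)
import Relation.Binary.Properties.DecTotalOrder as Strict
open import Relation.Binary.PropositionalEquality as ≡ using (_≡_; refl)
open import Relation.Nullary.Negation using (¬_; contradiction)
open import Relation.Unary using (Pred; _≐_; Satisfiable)

-- Orders are taken up to their setoid equality.  Decidability, which is
-- automatic under excluded middle, makes the antilexicographic order total.
LinearOrder : Set₁
LinearOrder = DecTotalOrder 0ℓ 0ℓ 0ℓ

∣_∣ : LinearOrder → Set
∣_∣ = DecTotalOrder.Carrier

infix 4 _⊢_≤_ _⊢_<_

_⊢_≤_ : (L : LinearOrder) → ∣ L ∣ → ∣ L ∣ → Set
L ⊢ x ≤ y = DecTotalOrder._≤_ L x y

-- x < y unfolds to x ≤ y × ¬ x ≈ y.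
_⊢_<_ : (L : LinearOrder) → ∣ L ∣ → ∣ L ∣ → Set
L ⊢ x < y = Strict._<_ L x y

setoidOf : LinearOrder → Setoid 0ℓ 0ℓ
setoidOf = DecTotalOrder.Eq.setoid

Finite : LinearOrder → Set
Finite L = ∃[ n ] Bijection (setoidOf L) (≡.setoid (Fin n))

Infinite : LinearOrder → Set
Infinite L = ¬ Finite L

Countable : LinearOrder → Set
Countable L = Injection (setoidOf L) (≡.setoid ℕ)

infix 4 _⪯_ _≺_ _≅_

-- Respect for ≈ and injectivity follow from antisymmetry.
_⪯_ : LinearOrder → LinearOrder → Set
L ⪯ L′ = Σ[ f ∈ (∣ L ∣ → ∣ L′ ∣) ] (∀ x y → (L ⊢ x ≤ y) ⇔ (L′ ⊢ f x ≤ f y))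

_≺_ : LinearOrder → LinearOrder → Set
L ≺ L′ = L ⪯ L′ × ¬ (L′ ⪯ L)

_≅_ : LinearOrder → LinearOrder → Set
L ≅ L′ = Σ[ f ∈ (∣ L ∣ → ∣ L′ ∣) ]
  IsOrderIsomorphism (DecTotalOrder._≈_ L) (DecTotalOrder._≈_ L′)
                     (DecTotalOrder._≤_ L) (DecTotalOrder._≤_ L′) f

------------------------------------------------------------------------
-- Convex sums

Convex : (L : LinearOrder) → Pred ∣ L ∣ 0ℓ → Set
Convex L I = ∀ {x y z} → L ⊢ x ≤ y → L ⊢ y ≤ z → I x → I z → I y

SetLeq : (L : LinearOrder) → Pred ∣ L ∣ 0ℓ → Pred ∣ L ∣ 0ℓ → Set
SetLeq L A B = ∀ {a b} → A a → B b → L ⊢ a ≤ b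

-- The field resp says that the family is indexed by K up to ≈.  Each member
-- respects the equality of K′ because it is convex.
record ConvexFamily (K K′ : LinearOrder) : Set₁ where
  field
    part     : ∣ K ∣ → Pred ∣ K′ ∣ 0ℓ
    resp     : ∀ {k₀ k₁} → DecTotalOrder._≈_ K k₀ k₁ → part k₀ ≐ part k₁
    nonempty : ∀ k → Satisfiable (part k)
    convex   : ∀ k → Convex K′ (part k)
    ordered  : ∀ {k₀ k₁} → K ⊢ k₀ < k₁ → SetLeq K′ (part k₀) (part k₁)

-- The library's product order compares first components first, hence the swap.
convexSum : (K K′ : LinearOrder) → ConvexFamily K K′ → LinearOrder
convexSum K K′ F = On.decTotalOrder (×-decTotalOrder K K′) toPair
  where
  toPair : Σ[ (x , k) ∈ ∣ K′ ∣ × ∣ K ∣ ] ConvexFamily.part F k x → ∣ K ∣ × ∣ K′ ∣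
  toPair = swap ∘ proj₁

-- Classes consist of nonempty linear orders, so downward closure only
-- concerns nonempty orders.
record CCS (𝓛 : LinearOrder → Set) : Set₁ where
  field
    downwardClosed : ∀ {L L′} → ∣ L ∣ → L ⪯ L′ → 𝓛 L′ → 𝓛 L
    sumClosed      : ∀ {K K′} → 𝓛 K → 𝓛 K′ →
                     (F : ConvexFamily K K′) → 𝓛 (convexSum K K′ F)

𝓛≺ : LinearOrder → LinearOrder → Set
𝓛≺ γ L = ∣ L ∣ × L ≺ γ

------------------------------------------------------------------------
-- Ordinals, as well-ordered sets up to isomorphism

record Ordinal : Set₁ where
  field
    order       : LinearOrder
    wellFounded : WellFounded (order ⊢_<_)

open Ordinal public using (order)

initialSegment : (L : LinearOrder) → ∣ L ∣ → LinearOrder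
initialSegment L c = On.decTotalOrder L inclusion
  where
  inclusion : Σ[ x ∈ ∣ L ∣ ] L ⊢ x < c → ∣ L ∣
  inclusion = proj₁

infix 4 _<ₒ_

_<ₒ_ : Ordinal → Ordinal → Set
α <ₒ β = ∃[ c ] order α ≅ initialSegment (order β) c

infixl 6 _+ₒ_

_+ₒ_ : Ordinal → Ordinal → Ordinal
α +ₒ β = record
  { order       = ⊎-<-decTotalOrder (order α) (order β)
  ; wellFounded = Subrelation.wellFounded strict
      (⊎-<-wellFounded (Ordinal.wellFounded α) (Ordinal.wellFounded β))
  }
  where
  strict : (⊎-<-decTotalOrder (order α) (order β) ⊢_<_)
             ⇒ ((order α ⊢_<_) ⊎-< (order β ⊢_<_))
  strict (₁∼₂     , _)   = ₁∼₂
  strict (₁∼₁ x≤y , x≉y) = ₁∼₁ (x≤y , x≉y ∘ inj₁)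
  strict (₂∼₂ x≤y , x≉y) = ₂∼₂ (x≤y , x≉y ∘ inj₂)

1ₒ : Ordinal
1ₒ = record
  { order       = Unit.≡-decTotalOrder
  ; wellFounded = λ _ → acc λ (_ , x≢y) → contradiction refl x≢y
  }

Indecomposable : Ordinal → Set₁
Indecomposable γ = ∣ order γ ∣ × (∀ α β → α <ₒ γ → β <ₒ γ → α +ₒ β <ₒ γ)

IsSuccessorOf : Ordinal → Ordinal → Set
IsSuccessorOf γ δ = order γ ≅ order (δ +ₒ 1ₒ)

{-# OPTIONS --safe #-}
module Submission where

-- Well-orders are compared by embeddings, and by ranks: any two well-orders
-- are comparable, in the strong form that either the first embeds into the
-- second or the second is isomorphic to a proper initial segment of the first
-- (comparable).  Hence a well-order lies in the class below γ as soon as γ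
-- does not embed into it.
--
-- For the closure under convex sums, send a point (x , k) of a sum to the pair
-- of its index k and its value x.  This identifies the sum with a chain in the
-- product K × K′, on which both coordinates are weakly increasing.  Each point
-- of the chain is of one of two kinds: either the index strictly increases at
-- every later point, or the value does (rises).  On the points of the first
-- kind the index is an embedding into K, on those of the second kind the value
-- is an embedding into K′.  An indecomposable ordinal is indivisible: whenever
-- it is split into two parts, it embeds into one of them
-- (indecomposable⇒indivisible).  So an indecomposable γ which embeds into the
-- sum embeds into K or K′.  If γ = δ + 1 with δ indecomposable, the same
-- argument applies to the points of the sum below the image of the top of γ;
-- then δ embeds into K or K′ below a point, and that point accommodates the
-- top again.
--
-- Indivisibility is proved by well-founded induction on the ordinal.  Let an
-- indecomposable α be the union of A and B.  Every tail of α embeds α, and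
-- there is a point c beyond which the tails of A, and those of B, are all of
-- the same length.  Say that the tail of A above c embeds into the tail Bᶜ of
-- B above c.  If α does not embed into B, then Bᶜ is shorter than α, hence
-- indivisible by induction, since it embeds into its own tails.  If the tail of
-- α above c did not embed into Bᶜ, then Bᶜ would embed between c and some point
-- e, hence into the part of A or of B between c and e.  But those parts are
-- strictly shorter than the tails of A and of B above c.  So α embeds into its
-- tail above c, thus into B after all (tail-⪯-longer).
--
-- Conversely, suppose that the class below γ is closed under convex sums, and
-- let c < m in γ.  Over the segment M of points below m, take all x ≤ c as the
-- part of the least index, and the singleton of c as every other part.  The sum
-- of this family embeds the ordinal sum of the segment below c and M, so γ does
-- not embed into the latter (Γ⋠segments).  If γ has no maximum, any two smaller
-- ordinals are segments below points c and d, and choosing m above both shows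
-- that their sum is smaller than γ.  If γ has a maximum m, then γ = M + 1.
-- For c , d < m, were M to embed into the sum of the segments below c and d,
-- then M + 1 = γ would embed into the sum of the segment below c and M, with d
-- as the image of the top.  Hence M is indecomposable.

open import Defs
open import Axiom.ExcludedMiddle using (ExcludedMiddle)
open import Data.Empty using (⊥-elim)
open import Data.Fin.Base using (zero)
open import Data.Product.Base using (∃-syntax; _×_; _,_; proj₁; proj₂; swap)
open import Data.Product.Relation.Binary.Lex.Strict using (×-wellFounded')
open import Data.Sum.Base using (_⊎_; inj₁; inj₂; [_,_]′; fromInj₁; fromInj₂)
  renaming (swap to swap⊎; map to map⊎)
open import Data.Sum.Relation.Binary.LeftOrder using (₁∼₂; ₁∼₁; ₂∼₂; ⊎-<-decTotalOrder)
import Data.Sum.Relation.Binary.Pointwise as Pointwise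
open import Data.Unit.Base using (tt)
open import Function.Base using (_∘_; id)
open import Function.Bundles using (_⇔_; mk⇔; Equivalence)
open import Induction.WellFounded using (WellFounded; Acc; acc; module Subrelation)
open import Level using (0ℓ; suc; Lift; lift; lower)
open import Relation.Binary.Bundles using (DecTotalOrder)
import Relation.Binary.Construct.NonStrictToStrict as ToStrict
import Relation.Binary.Construct.On as On
open import Relation.Binary.Morphism.Structures using (IsOrderIsomorphism)
import Relation.Binary.Properties.DecTotalOrder as Strict
open import Relation.Binary.PropositionalEquality using (refl)
import Relation.Binary.Reasoning.Base.Single as SingleReasoning
open import Relation.Nullary.Decidable using (Dec; yes; no; map′; decidable-stable)
open import Relation.Nullary.Negation using (¬_; contradiction)
open import Relation.Unary using (Pred; _∩_; _⊆_; _⊢_)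

-- Laws of a linear order together with its strict part.
module Lin (L : LinearOrder) where
  open DecTotalOrder L public
    using (_≈_; _≤_; _≟_; _≤?_; total; antisym; reflexive; module Eq)
    renaming (refl to ≤-refl; trans to ≤-trans)
  open Strict L public using (_<_; <-trans; ≰⇒>; ≮⇒≥; <⇒≱; <-respʳ-≈)

  ≤-<-trans : ∀ {x y z} → x ≤ y → y < z → x < z
  ≤-<-trans = ToStrict.≤-<-trans _≈_ _≤_ ≤-trans antisym (DecTotalOrder.≤-respˡ-≈ L)

  <-≤-trans : ∀ {x y z} → x < y → y ≤ z → x < z
  <-≤-trans =
    ToStrict.<-≤-trans _≈_ _≤_ Eq.sym ≤-trans antisym (DecTotalOrder.≤-respʳ-≈ L)

-- Embeddings and suborders

embed : ∀ {L M} (f : ∣ L ∣ → ∣ M ∣) →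
        (∀ {x y} → L ⊢ x ≤ y → M ⊢ f x ≤ f y) →
        (∀ {x y} → L ⊢ x < y → M ⊢ f x < f y) → L ⪯ M
embed {L} {M} f mono strict = f , λ x y → mk⇔ mono (cancel x y)
  where
  module L = Lin L
  module M = Lin M
  cancel : ∀ x y → M ⊢ f x ≤ f y → L ⊢ x ≤ y
  cancel x y fx≤fy with x L.≤? y
  ... | yes x≤y = x≤y
  ... | no  x≰y = contradiction fx≤fy (M.<⇒≱ (strict (L.≰⇒> x≰y)))

module Embedding {L M : LinearOrder} (e : L ⪯ M) where
  private
    module L = Lin L
    module M = Lin M

  f : ∣ L ∣ → ∣ M ∣
  f = proj₁ e

  mono : ∀ {x y} → L ⊢ x ≤ y → M ⊢ f x ≤ f y
  mono = Equivalence.to (proj₂ e _ _)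

  cancel : ∀ {x y} → M ⊢ f x ≤ f y → L ⊢ x ≤ y
  cancel = Equivalence.from (proj₂ e _ _)

  cong : ∀ {x y} → x L.≈ y → f x M.≈ f y
  cong x≈y = M.antisym (mono (L.reflexive x≈y)) (mono (L.reflexive (L.Eq.sym x≈y)))

  injective : ∀ {x y} → f x M.≈ f y → x L.≈ y
  injective fx≈fy =
    L.antisym (cancel (M.reflexive fx≈fy)) (cancel (M.reflexive (M.Eq.sym fx≈fy)))

  strict : ∀ {x y} → L ⊢ x < y → M ⊢ f x < f y
  strict (x≤y , x≉y) = mono x≤y , x≉y ∘ injective

⪯-trans : ∀ {L M N} → L ⪯ M → M ⪯ N → L ⪯ N
⪯-trans {L} {M} {N} e e′ =
  E′.f ∘ E.f , λ x y → mk⇔ (E′.mono ∘ E.mono) (E.cancel ∘ E′.cancel)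
  where
  module E = Embedding {L} {M} e
  module E′ = Embedding {M} {N} e′

⪯-refl : ∀ {L} → L ⪯ L
⪯-refl = id , λ _ _ → mk⇔ id id

module ⪯-Reasoning =
  SingleReasoning _⪯_ (λ {L} → ⪯-refl {L}) (λ {L} {M} {N} → ⪯-trans {L} {M} {N})

⪯-wellFounded : ∀ {L M} → L ⪯ M → WellFounded (M ⊢_<_) → WellFounded (L ⊢_<_)
⪯-wellFounded {L} {M} e wf = Subrelation.wellFounded E.strict (On.wellFounded E.f wf)
  where module E = Embedding {L} {M} e

-- A strictly increasing self-map of a well-order never moves a point down.
¬⪯-initialSegment : (α : Ordinal) (c : ∣ order α ∣) →
                    ¬ (order α ⪯ initialSegment (order α) c)
¬⪯-initialSegment α c e = descend (Ordinal.wellFounded α c) (proj₂ (E.f c))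
  where
  module E = Embedding {order α} {initialSegment (order α) c} e
  descend : ∀ {x} → Acc (order α ⊢_<_) x → ¬ (order α ⊢ proj₁ (E.f x) < x)
  descend (acc rs) fx<x = descend (rs fx<x) (E.strict fx<x)

infixl 8 _↾_ _↾ₒ_

-- The suborder of L on the points that satisfy P.
_↾_ : (L : LinearOrder) → Pred ∣ L ∣ 0ℓ → LinearOrder
L ↾ P = On.decTotalOrder L (proj₁ {B = P})

↾-⪯ : ∀ {L P} → L ↾ P ⪯ L
↾-⪯ = proj₁ , λ _ _ → mk⇔ id id

⪯-↾ : ∀ {L M} {Q : Pred ∣ M ∣ 0ℓ} (e : L ⪯ M) → (∀ x → Q (proj₁ e x)) → L ⪯ M ↾ Q
⪯-↾ e q = (λ x → proj₁ e x , q x) , proj₂ e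

↾-mono : ∀ {L} {P Q : Pred ∣ L ∣ 0ℓ} → P ⊆ Q → L ↾ P ⪯ L ↾ Q
↾-mono {L} {P} {Q} P⊆Q = ⪯-↾ {L ↾ P} {L} {Q} (↾-⪯ {L} {P}) (P⊆Q ∘ proj₂)

-- f ⊢ Q is the preimage of Q under f.
↾-preimage : ∀ {L M} {Q : Pred ∣ M ∣ 0ℓ} (e : L ⪯ M) → L ↾ (proj₁ e ⊢ Q) ⪯ M ↾ Q
↾-preimage {L} {M} {Q} e =
  ⪯-↾ {L ↾ (proj₁ e ⊢ Q)} {M} {Q}
    (⪯-trans {L ↾ (proj₁ e ⊢ Q)} {L} {M} (↾-⪯ {L} {proj₁ e ⊢ Q}) e) proj₂

initialSegment-mono : ∀ {L M} (e : L ⪯ M) (c : ∣ L ∣) →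
                      initialSegment L c ⪯ initialSegment M (proj₁ e c)
initialSegment-mono {L} {M} e c =
  (λ (x , x<c) → E.f x , E.strict x<c) , λ (x , _) (y , _) → mk⇔ E.mono E.cancel
  where module E = Embedding {L} {M} e

-- The points of L from c on, c included.
tail : (L : LinearOrder) → ∣ L ∣ → Pred ∣ L ∣ 0ℓ
tail L c x = L ⊢ c ≤ x

_↾ₒ_ : (α : Ordinal) → Pred ∣ order α ∣ 0ℓ → Ordinal
α ↾ₒ P = record
  { order       = order α ↾ P
  ; wellFounded = ⪯-wellFounded {order α ↾ P} {order α} (↾-⪯ {order α} {P})
                    (Ordinal.wellFounded α)
  }

initialSegmentₒ : (α : Ordinal) → ∣ order α ∣ → Ordinal
initialSegmentₒ α c = α ↾ₒ (λ x → order α ⊢ x < c)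

-- Isomorphisms

⪯-surjective⇒≅ : ∀ {L M} (e : L ⪯ M) →
                 (∀ y → ∃[ x ] DecTotalOrder._≈_ M (proj₁ e x) y) → L ≅ M
⪯-surjective⇒≅ {L} {M} e surj = E.f , record
  { isOrderMonomorphism = record
    { isOrderHomomorphism = record { cong = E.cong ; mono = E.mono }
    ; injective = E.injective
    ; cancel    = E.cancel
    }
  ; surjective = λ y → let (x , fx≈y) = surj y in
                 x , λ z≈x → DecTotalOrder.Eq.trans M (E.cong z≈x) fx≈y
  }
  where module E = Embedding {L} {M} e

≅⇒⪯ : ∀ {L M} → L ≅ M → L ⪯ M
≅⇒⪯ (f , iso) = f , λ _ _ → mk⇔ I.mono I.cancel
  where module I = IsOrderIsomorphism iso

≅⇒⪰ : ∀ {L M} → L ≅ M → M ⪯ L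
≅⇒⪰ {L} {M} (f , iso) = g , λ x y → mk⇔
  (λ x≤y → I.cancel (M.≤-trans (M.reflexive (fg≈ x))
                      (M.≤-trans x≤y (M.reflexive (M.Eq.sym (fg≈ y))))))
  (λ gx≤gy → M.≤-trans (M.reflexive (M.Eq.sym (fg≈ x)))
               (M.≤-trans (I.mono gx≤gy) (M.reflexive (fg≈ y))))
  where
  module I = IsOrderIsomorphism iso
  module L = Lin L
  module M = Lin M
  g : ∣ M ∣ → ∣ L ∣
  g y = proj₁ (I.surjective y)
  fg≈ : ∀ y → f (g y) M.≈ y
  fg≈ y = proj₂ (I.surjective y) L.Eq.refl

initialSegment-<ₒ : (α : Ordinal) (c : ∣ order α ∣) → initialSegmentₒ α c <ₒ α
initialSegment-<ₒ α c = c , ⪯-surjective⇒≅ {seg} {seg} (id , λ _ _ → mk⇔ id id)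
                              (λ y → y , DecTotalOrder.Eq.refl seg {y})
  where seg = initialSegment (order α) c

<ₒ⇒¬⪰ : ∀ α β → α <ₒ β → ¬ (order β ⪯ order α)
<ₒ⇒¬⪰ α β (c , α≅) β⪯α = ¬⪯-initialSegment β c
  (⪯-trans {order β} {order α} {seg} β⪯α (≅⇒⪯ {order α} {seg} α≅))
  where seg = initialSegment (order β) c

<ₒ⇒⪯ : ∀ α β → α <ₒ β → order α ⪯ order β
<ₒ⇒⪯ α β (c , α≅) = ⪯-trans {order α} {seg} {order β} (≅⇒⪯ {order α} {seg} α≅)
                      (↾-⪯ {order β})
  where seg = initialSegment (order β) c

-- An embedding of α into the segment below c carries the segments of α to
-- suborders of segments below points smaller than c.
<ₒ-wellFounded : WellFounded _<ₒ_
<ₒ-wellFounded β = acc λ { {α} (c , α≅) →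
  accBelow (Ordinal.wellFounded β c) α (≅⇒⪯ {order α} {initialSegment (order β) c} α≅) }
  where
  accBelow : ∀ {c} → Acc (order β ⊢_<_) c → ∀ α →
             order α ⪯ initialSegment (order β) c → Acc _<ₒ_ α
  accBelow {c} (acc rs) α e = acc λ { {α′} (d , α′≅) →
    accBelow (rs (proj₂ (proj₁ e d))) α′
      (⪯-trans {order α′} {initialSegment (order α) d} {initialSegment (order β) _}
        (≅⇒⪯ {order α′} {initialSegment (order α) d} α′≅)
        (initialSegment-mono {order α} {order β}
          (⪯-trans {order α} {initialSegment (order β) c} {order β} e (↾-⪯ {order β})) d)) }

-- Ordered sums

+-initialSegment : ∀ {L L′ M M′} {d : ∣ M′ ∣} → L ⪯ L′ → M ⪯ initialSegment M′ d →
  ⊎-<-decTotalOrder L M ⪯ initialSegment (⊎-<-decTotalOrder L′ M′) (inj₂ d)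
+-initialSegment {L} {L′} {M} {M′} {d} e e′ = g , λ x y → mk⇔ (to x y) (from x y)
  where
  module E = Embedding {L} {L′} e
  module E′ = Embedding {M} {initialSegment M′ d} e′
  g : ∣ ⊎-<-decTotalOrder L M ∣ → ∣ initialSegment (⊎-<-decTotalOrder L′ M′) (inj₂ d) ∣
  g (inj₁ x) = inj₁ (E.f x) , ₁∼₂ , λ ()
  g (inj₂ y) = let (y′ , y′≤d , y′≉d) = E′.f y in
    inj₂ y′ , ₂∼₂ y′≤d , λ { (Pointwise.inj₂ y′≈d) → y′≉d y′≈d }
  to : ∀ x y → ⊎-<-decTotalOrder L M ⊢ x ≤ y →
       ⊎-<-decTotalOrder L′ M′ ⊢ proj₁ (g x) ≤ proj₁ (g y)
  to _ _ ₁∼₂       = ₁∼₂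
  to _ _ (₁∼₁ x≤y) = ₁∼₁ (E.mono x≤y)
  to _ _ (₂∼₂ x≤y) = ₂∼₂ (E′.mono x≤y)
  from : ∀ x y → ⊎-<-decTotalOrder L′ M′ ⊢ proj₁ (g x) ≤ proj₁ (g y) →
         ⊎-<-decTotalOrder L M ⊢ x ≤ y
  from (inj₁ _) (inj₁ _) (₁∼₁ x≤y) = ₁∼₁ (E.cancel x≤y)
  from (inj₁ _) (inj₂ _) _         = ₁∼₂
  from (inj₂ _) (inj₂ _) (₂∼₂ x≤y) = ₂∼₂ (E′.cancel x≤y)

-- An order is the sum of an initial segment and the complementary tail.
⪯-cut : ∀ L (c : ∣ L ∣) → L ⪯ ⊎-<-decTotalOrder (initialSegment L c) (L ↾ tail L c)
⪯-cut L c = (λ x → place (c L.≤? x)) , λ x y → mk⇔ (to (c L.≤? x) (c L.≤? y))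
                                                  (from (c L.≤? x) (c L.≤? y))
  where
  module L = Lin L
  cut = ⊎-<-decTotalOrder (initialSegment L c) (L ↾ tail L c)
  place : ∀ {x} → Dec (L ⊢ c ≤ x) → ∣ cut ∣
  place {x} (yes c≤x) = inj₂ (x , c≤x)
  place {x} (no  c≰x) = inj₁ (x , L.≰⇒> c≰x)
  to : ∀ {x y} (p : Dec (L ⊢ c ≤ x)) (q : Dec (L ⊢ c ≤ y)) →
       L ⊢ x ≤ y → cut ⊢ place p ≤ place q
  to (yes _)   (yes _)   x≤y = ₂∼₂ x≤y
  to (yes c≤x) (no  c≰y) x≤y = contradiction (L.≤-trans c≤x x≤y) c≰y
  to (no  _)   (yes _)   x≤y = ₁∼₂
  to (no  _)   (no  _)   x≤y = ₁∼₁ x≤y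
  from : ∀ {x y} (p : Dec (L ⊢ c ≤ x)) (q : Dec (L ⊢ c ≤ y)) →
         cut ⊢ place p ≤ place q → L ⊢ x ≤ y
  from (yes _)   (yes _)   (₂∼₂ x≤y) = x≤y
  from (no  c≰x) (yes c≤y) _         = L.≤-trans (proj₁ (L.≰⇒> c≰x)) c≤y
  from (no  _)   (no  _)   (₁∼₁ x≤y) = x≤y

successor-⪯ : ∀ δ {M} {c : ∣ M ∣} → order δ ⪯ initialSegment M c → order (δ +ₒ 1ₒ) ⪯ M
successor-⪯ δ {M} {c} e = g , λ x y → mk⇔ (to x y) (from x y)
  where
  module M = Lin M
  module E = Embedding {order δ} {initialSegment M c} e
  g : ∣ order (δ +ₒ 1ₒ) ∣ → ∣ M ∣
  g (inj₁ x) = proj₁ (E.f x)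
  g (inj₂ _) = c
  to : ∀ x y → order (δ +ₒ 1ₒ) ⊢ x ≤ y → M ⊢ g x ≤ g y
  to (inj₁ x) _ ₁∼₂       = proj₁ (proj₂ (E.f x))
  to _        _ (₁∼₁ x≤y) = E.mono x≤y
  to _        _ (₂∼₂ _)   = M.≤-refl
  from : ∀ x y → M ⊢ g x ≤ g y → order (δ +ₒ 1ₒ) ⊢ x ≤ y
  from (inj₁ _) (inj₁ _) x≤y = ₁∼₁ (E.cancel x≤y)
  from (inj₁ _) (inj₂ _) _   = ₁∼₂
  from (inj₂ _) (inj₁ y) c≤y = contradiction c≤y (M.<⇒≱ (proj₂ (E.f y)))
  from (inj₂ _) (inj₂ _) _   = ₂∼₂ refl

successor-⪯⁻¹ : ∀ δ {M} → order (δ +ₒ 1ₒ) ⪯ M → ∃[ c ] order δ ⪯ initialSegment M c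
successor-⪯⁻¹ δ {M} e = E.f (inj₂ tt) ,
  (λ x → E.f (inj₁ x) , E.strict (₁∼₂ , λ ())) ,
  λ x y → mk⇔ (E.mono ∘ ₁∼₁) (λ fx≤fy → drop (E.cancel fx≤fy))
  where
  module E = Embedding {order (δ +ₒ 1ₒ)} {M} e
  drop : ∀ {x y} → order (δ +ₒ 1ₒ) ⊢ inj₁ x ≤ inj₁ y → order δ ⊢ x ≤ y
  drop (₁∼₁ x≤y) = x≤y

maximum⇒successor : (γ : Ordinal) {m : ∣ order γ ∣} → (∀ x → order γ ⊢ x ≤ m) →
                    IsSuccessorOf γ (initialSegmentₒ γ m)
maximum⇒successor γ {m} max = ⪯-surjective⇒≅ {order γ} {order (δ +ₒ 1ₒ)}
  ((λ x → place (x L.≟ m)) ,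
    λ x y → mk⇔ (to (x L.≟ m) (y L.≟ m)) (from (x L.≟ m) (y L.≟ m)))
  (λ y → inverse y , place-inverse y (inverse y L.≟ m))
  where
  module L = Lin (order γ)
  δ = initialSegmentₒ γ m
  place : ∀ {x} → Dec (x L.≈ m) → ∣ order (δ +ₒ 1ₒ) ∣
  place     (yes _)   = inj₂ tt
  place {x} (no  x≉m) = inj₁ (x , max x , x≉m)
  to : ∀ {x y} (p : Dec (x L.≈ m)) (q : Dec (y L.≈ m)) →
       x L.≤ y → order (δ +ₒ 1ₒ) ⊢ place p ≤ place q
  to     (yes _)   (yes _)   _   = ₂∼₂ refl
  to {y = y} (yes x≈m) (no  y≉m) x≤y =
    contradiction (L.antisym (max y) (L.≤-trans (L.reflexive (L.Eq.sym x≈m)) x≤y)) y≉m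
  to     (no  _)   (yes _)   _   = ₁∼₂
  to     (no  _)   (no  _)   x≤y = ₁∼₁ x≤y
  from : ∀ {x y} (p : Dec (x L.≈ m)) (q : Dec (y L.≈ m)) →
         order (δ +ₒ 1ₒ) ⊢ place p ≤ place q → x L.≤ y
  from {x} _         (yes y≈m) _         = L.≤-trans (max x) (L.reflexive (L.Eq.sym y≈m))
  from     (no  _)   (no  _)   (₁∼₁ x≤y) = x≤y
  inverse : ∣ order (δ +ₒ 1ₒ) ∣ → ∣ order γ ∣
  inverse (inj₁ (x , _)) = x
  inverse (inj₂ _)       = m
  place-inverse : ∀ y (p : Dec (inverse y L.≈ m)) →
                  DecTotalOrder._≈_ (order (δ +ₒ 1ₒ)) (place p) y
  place-inverse (inj₁ (_ , _ , x≉m)) (yes x≈m) = contradiction x≈m x≉m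
  place-inverse (inj₁ _)             (no  _)   = Pointwise.inj₁ L.Eq.refl
  place-inverse (inj₂ _)             (yes _)   = Pointwise.inj₂ refl
  place-inverse (inj₂ _)             (no  m≉m) = contradiction L.Eq.refl m≉m

-- Comparing points of two orders by rank

-- For well-founded L and M this says that the rank of x in L is at most the
-- rank of y in M.
data Rank≤ (L M : LinearOrder) : ∣ L ∣ → ∣ M ∣ → Set where
  below : ∀ {x y} →
          (∀ {x′} → L ⊢ x′ < x → ∃[ y′ ] (M ⊢ y′ < y) × Rank≤ L M x′ y′) →
          Rank≤ L M x y

Rank≤-lowerˡ : ∀ {L M x x′ y} → L ⊢ x ≤ x′ → Rank≤ L M x′ y → Rank≤ L M x y
Rank≤-lowerˡ {L} x≤x′ (below h) = below λ x″<x → h (Lin.<-≤-trans L x″<x x≤x′)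

-- Following x′ < x into M and back produces the same situation at x′ instead
-- of x.
Rank≤-irrefl : ∀ {L M x y x′} → Acc (L ⊢_<_) x →
               Rank≤ L M x y → Rank≤ M L y x′ → ¬ (L ⊢ x′ < x)
Rank≤-irrefl (acc rs) (below h) (below h′) x′<x =
  let (y′ , y′<y , r)   = h x′<x
      (x″ , x″<x′ , r′) = h′ y′<y
  in Rank≤-irrefl (rs x′<x) r r′ x″<x′

module Comparability (em : ExcludedMiddle 0ℓ) where

  ¬∃⇒∀ : {A : Set} {P : A → Set} → ¬ (∃[ x ] ¬ P x) → ∀ x → P x
  ¬∃⇒∀ h x = decidable-stable em λ ¬px → h (x , ¬px)

  least : (α : Ordinal) (P : Pred ∣ order α ∣ 0ℓ) → ∃[ x ] P x →
          ∃[ m ] P m × (∀ y → P y → order α ⊢ m ≤ y)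
  least α P (x , px) = search (Ordinal.wellFounded α x) px
    where
    search : ∀ {x} → Acc (order α ⊢_<_) x → P x →
             ∃[ m ] P m × (∀ y → P y → order α ⊢ m ≤ y)
    search {x} (acc rs) px with em {∃[ y ] P y × order α ⊢ y < x}
    ... | yes (y , py , y<x) = search (rs y<x) py
    ... | no  none           = x , px ,
      λ y py → Lin.≮⇒≥ (order α) λ y<x → none (y , py , y<x)

  -- Ranks are linearly ordered: the second case says that y has smaller rank
  -- than x.
  Rank≤-total : ∀ {L} M {x} → Acc (L ⊢_<_) x → ∀ y →
                Rank≤ L M x y ⊎ ∃[ x′ ] (L ⊢ x′ < x) × Rank≤ M L y x′
  Rank≤-total {L} M {x} (acc rs) y
    with em {∃[ x′ ] (L ⊢ x′ < x) × ¬ (∃[ y′ ] (M ⊢ y′ < y) × Rank≤ L M x′ y′)}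
  ... | no  none = inj₁ (below λ {x′} x′<x → decidable-stable em λ ¬p →
                           none (x′ , x′<x , ¬p))
  ... | yes (x′ , x′<x , ¬p) = inj₂ (x′ , x′<x , below λ {y′} y′<y →
          fromInj₂ (λ r → contradiction (y′ , y′<y , r) ¬p)
            (Rank≤-total M (rs x′<x) y′))

  -- If every point of L is dominated in rank by a point of β, then sending x to
  -- the least point that dominates it embeds L into β.
  module RankMap (L : LinearOrder) (β : Ordinal)
                 (dominated : ∀ x → ∃[ y ] Rank≤ L (order β) x y) where
    private module B = Lin (order β)

    f : ∣ L ∣ → ∣ order β ∣
    f x = proj₁ (least β (Rank≤ L (order β) x) (dominated x))

    rank : ∀ x → Rank≤ L (order β) x (f x)
    rank x = proj₁ (proj₂ (least β (Rank≤ L (order β) x) (dominated x)))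

    minimal : ∀ x y → Rank≤ L (order β) x y → order β ⊢ f x ≤ y
    minimal x = proj₂ (proj₂ (least β (Rank≤ L (order β) x) (dominated x)))

    embedding : L ⪯ order β
    embedding = embed {L} {order β} f
      (λ {x} {x′} x≤x′ → minimal x (f x′) (Rank≤-lowerˡ x≤x′ (rank x′)))
      (λ {x} {x′} x<x′ → strict x (rank x′) x<x′)
      where
      strict : ∀ x {x′ y} → Rank≤ L (order β) x′ y → L ⊢ x < x′ → order β ⊢ f x < y
      strict x (below h) x<x′ = let (y′ , y′<y , r) = h x<x′ in
        B.≤-<-trans (minimal x y′ r) y′<y

  comparable : (α β : Ordinal) → order α ⪯ order β ⊎ β <ₒ α
  comparable α β with em {∃[ x ] ¬ (∃[ y ] Rank≤ (order α) (order β) x y)}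
  ... | no  none = inj₁ (RankMap.embedding (order α) β (¬∃⇒∀ none))
  ... | yes undominated = inj₂ (c , ⪯-surjective⇒≅ {order β} {segment}
          (⪯-↾ {order β} {order α} R.embedding f<c) surjective)
    where
    module A = Lin (order α)
    -- The least point of α that no point of β dominates in rank.
    exceeds-β = least α _ undominated
    c = proj₁ exceeds-β
    segment = initialSegment (order α) c

    dominates : ∀ y → ∃[ x ] (order α ⊢ x < c) × Rank≤ (order β) (order α) y x
    dominates y = fromInj₂ (λ r → contradiction (y , r) (proj₁ (proj₂ exceeds-β)))
                    (Rank≤-total (order β) (Ordinal.wellFounded α c) y)

    dominated : ∀ y → ∃[ x ] Rank≤ (order β) (order α) y x
    dominated y = let (x , _ , r) = dominates y in x , r

    module R = RankMap (order β) α dominated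

    f<c : ∀ y → order α ⊢ R.f y < c
    f<c y = let (x , x<c , r) = dominates y in A.≤-<-trans (R.minimal y x r) x<c

    -- The preimage of x is the least point of β of rank at least that of x.
    surjective : ∀ (x : ∣ segment ∣) → ∃[ y ] R.f y A.≈ proj₁ x
    surjective (x , x<c) = y , A.antisym (R.minimal y x ryx)
        (A.≮⇒≥ (Rank≤-irrefl (Ordinal.wellFounded α x) rxy (R.rank y)))
      where
      leastImage = least β (Rank≤ (order α) (order β) x)
        (decidable-stable em λ ¬d → A.<⇒≱ x<c (proj₂ (proj₂ exceeds-β) x ¬d))
      y = proj₁ leastImage
      rxy = proj₁ (proj₂ leastImage)
      ryx : Rank≤ (order β) (order α) y x
      ryx = fromInj₁ (λ (y′ , y′<y , r) → contradiction (proj₂ (proj₂ leastImage) y′ r)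
                                              (Lin.<⇒≱ (order β) y′<y))
              (Rank≤-total (order α) (Ordinal.wellFounded β y) x)

  ¬⪯⇒<ₒ : ∀ α β → ¬ (order α ⪯ order β) → β <ₒ α
  ¬⪯⇒<ₒ α β ¬α⪯β = fromInj₂ (λ α⪯β → contradiction α⪯β ¬α⪯β) (comparable α β)

  -- Every nonempty family of ordinals has a shortest member.
  ⪯-minimum : {I : Set} (F : I → Ordinal) → I →
              ∃[ i ] (∀ j → order (F i) ⪯ order (F j))
  ⪯-minimum F i = search i (<ₒ-wellFounded (F i))
    where
    search : ∀ i → Acc _<ₒ_ (F i) → ∃[ i ] (∀ j → order (F i) ⪯ order (F j))
    search i (acc rs) with em {∃[ j ] ¬ (order (F i) ⪯ order (F j))}
    ... | no  none   = i , ¬∃⇒∀ none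
    ... | yes (j , h) = search j (rs (¬⪯⇒<ₒ (F i) (F j) h))

-- Indivisibility

-- Every nonempty final segment embeds the whole order.  It is enough to ask
-- this of the tails from a point on.
RightIndecomposable : LinearOrder → Set
RightIndecomposable L = ∀ c → L ⪯ L ↾ tail L c

-- Whenever the order is covered by two sets, it embeds into one of them.
Indivisible : LinearOrder → Set₁
Indivisible L = ∀ (A B : Pred ∣ L ∣ 0ℓ) → (∀ x → A x ⊎ B x) → L ⪯ L ↾ A ⊎ L ⪯ L ↾ B

indivisible-⪯ : ∀ {L M} → Indivisible L → L ⪯ M →
                (A B : Pred ∣ M ∣ 0ℓ) → (∀ x → A x ⊎ B x) → L ⪯ M ↾ A ⊎ L ⪯ M ↾ B
indivisible-⪯ {L} {M} ind e A B cover = map⊎ (into A) (into B)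
  (ind (proj₁ e ⊢ A) (proj₁ e ⊢ B) (cover ∘ proj₁ e))
  where
  into : ∀ P → L ⪯ L ↾ (proj₁ e ⊢ P) → L ⪯ M ↾ P
  into P h = ⪯-trans {L} {L ↾ (proj₁ e ⊢ P)} {M ↾ P} h (↾-preimage {L} {M} {P} e)

-- A part Q of P that lies below a point e is strictly shorter than P, provided
-- that P is nonempty and embeds into its part above e.  That part then has a
-- point, and Q lies in the segment of P below it.
¬⪯-below : (α : Ordinal) (P Q : Pred ∣ order α ∣ 0ℓ) (e : ∣ order α ∣) →
           (∀ x → Q x → P x × order α ⊢ x < e) → ∣ order α ↾ P ∣ →
           order α ↾ P ⪯ order α ↾ (tail (order α) e ∩ P) →
           ¬ (order α ↾ P ⪯ order α ↾ Q)
¬⪯-below α P Q e Q⊆ p stable P⪯Q = ¬⪯-initialSegment (α ↾ₒ P) p′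
  (⪯-trans {order α ↾ P} {order α ↾ Q} {initialSegment (order α ↾ P) p′} P⪯Q
    ((λ (x , qx) → (x , proj₁ (Q⊆ x qx)) , A.<-≤-trans (proj₂ (Q⊆ x qx)) e≤p′) ,
     λ _ _ → mk⇔ id id))
  where
  module A = Lin (order α)
  beyond = proj₁ stable p
  e≤p′ = proj₁ (proj₂ beyond)
  p′ : ∣ order α ↾ P ∣
  p′ = proj₁ beyond , proj₂ (proj₂ beyond)

module Indivisibility (em : ExcludedMiddle 0ℓ) where
  open Comparability em
  open ⪯-Reasoning

  -- Beyond some point c, the tails of P are all of the same length.
  stableTail : (α : Ordinal) (P : Pred ∣ order α ∣ 0ℓ) → ∣ order α ∣ →
    ∃[ c ] (∀ d → order α ↾ (tail (order α) c ∩ P) ⪯ order α ↾ (tail (order α) d ∩ P))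
  stableTail α P = ⪯-minimum (λ c → α ↾ₒ (tail (order α) c ∩ P))

  -- When A and B cover α and their tails above c do not shrink further, the
  -- longer of these two tails, here that of B, embeds the tail of α above c if
  -- it is indivisible.
  tail-⪯-longer : (α : Ordinal) (A B : Pred ∣ order α ∣ 0ℓ) (c : ∣ order α ∣) →
    let L = order α ; Aᶜ = tail L c ∩ A ; Bᶜ = tail L c ∩ B in
    (∀ x → A x ⊎ B x) →
    (∀ d → L ↾ Aᶜ ⪯ L ↾ (tail L d ∩ A)) → (∀ d → L ↾ Bᶜ ⪯ L ↾ (tail L d ∩ B)) →
    L ↾ Aᶜ ⪯ L ↾ Bᶜ → Indivisible (L ↾ Bᶜ) →
    L ↾ tail L c ⪯ L ↾ Bᶜ
  tail-⪯-longer α A B c cover stableA stableB A⪯B ind =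
    fromInj₁ (λ B<T → ⊥-elim (absurd B<T)) (comparable T (α ↾ₒ Bᶜ))
    where
    L = order α
    module L = Lin L
    T = α ↾ₒ tail L c
    Aᶜ = tail L c ∩ A
    Bᶜ = tail L c ∩ B

    -- The point c itself lies in A or in B, so that the tail of B has a point.
    b : ∣ L ↾ Bᶜ ∣
    b = [ (λ a → proj₁ A⪯B (c , L.≤-refl , a)) , (λ b → c , L.≤-refl , b) ]′ (cover c)

    -- If the tail of B were shorter than the whole tail, it would fit below
    -- some point e, hence into the part below e of A or of B.
    absurd : ¬ (α ↾ₒ Bᶜ <ₒ T)
    absurd ((e , c≤e) , B≅) =
      [ (λ B⪯ → ¬⪯-below α Aᶜ (Below A) e (below⊆ A)
                  (proj₁ (proj₁ B⪯ b) , proj₁ (below⊆ A _ (proj₂ (proj₁ B⪯ b))))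
                  (restable A (stableA e))
                  (⪯-trans {L ↾ Aᶜ} {L ↾ Bᶜ} {L ↾ Below A} A⪯B B⪯))
      , ¬⪯-below α Bᶜ (Below B) e (below⊆ B) b (restable B (stableB e))
      ]′ (map⊎ (flatten A) (flatten B)
           (indivisible-⪯ {L ↾ Bᶜ} {segment} ind (≅⇒⪯ {L ↾ Bᶜ} {segment} B≅)
             (A ∘ proj₁ ∘ proj₁) (B ∘ proj₁ ∘ proj₁) (cover ∘ proj₁ ∘ proj₁)))
      where
      segment = initialSegment (order T) (e , c≤e)
      Below : Pred ∣ L ∣ 0ℓ → Pred ∣ L ∣ 0ℓ
      Below P x = (tail L c x × L ⊢ x < e) × P x
      below⊆ : ∀ P x → Below P x → (tail L c x × P x) × L ⊢ x < e
      below⊆ P x ((c≤x , x<e) , px) = (c≤x , px) , x<e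
      flatten : ∀ P → L ↾ Bᶜ ⪯ segment ↾ (P ∘ proj₁ ∘ proj₁) → L ↾ Bᶜ ⪯ L ↾ Below P
      flatten P = λ h → ⪯-trans {L ↾ Bᶜ} {segment ↾ (P ∘ proj₁ ∘ proj₁)} {L ↾ Below P} h
        ((λ (((x , c≤x) , x<e) , px) → x , (c≤x , x<e) , px) , λ _ _ → mk⇔ id id)
      -- The point e lies above c, so the tail of P above e is a part of the
      -- tail of P above c.
      restable : ∀ P → L ↾ (tail L c ∩ P) ⪯ L ↾ (tail L e ∩ P) →
                 L ↾ (tail L c ∩ P) ⪯ L ↾ (tail L e ∩ (tail L c ∩ P))
      restable P h = ⪯-trans {L ↾ (tail L c ∩ P)} {L ↾ (tail L e ∩ P)}
        {L ↾ (tail L e ∩ (tail L c ∩ P))} h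
        (↾-mono {L} λ (e≤x , px) → e≤x , L.≤-trans c≤e e≤x , px)

  rightIndecomposable⇒indivisible : (α : Ordinal) → RightIndecomposable (order α) →
                                    Indivisible (order α)
  rightIndecomposable⇒indivisible α = go α (<ₒ-wellFounded α)
    where
    go : ∀ α → Acc _<ₒ_ α → RightIndecomposable (order α) → Indivisible (order α)
    go α (acc rs) rightInd A B cover with em {∣ L ∣}
      where L = order α
    ... | no  empty = inj₁ ((λ x → ⊥-elim (empty x)) , λ x → ⊥-elim (empty x))
    ... | yes x₀ = [ longer A B cover stableA stableB
                   , swap⊎ ∘ longer B A (swap⊎ ∘ cover) stableB stableA ∘
                     <ₒ⇒⪯ (α ↾ₒ (tail L c ∩ B)) (α ↾ₒ (tail L c ∩ A))
                   ]′ (comparable (α ↾ₒ (tail L c ∩ A)) (α ↾ₒ (tail L c ∩ B)))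
      where
      L = order α
      module L = Lin L

      Stable : Pred ∣ L ∣ 0ℓ → ∣ L ∣ → Set
      Stable P c = ∀ d → L ↾ (tail L c ∩ P) ⪯ L ↾ (tail L d ∩ P)

      c₁ = proj₁ (stableTail α A x₀)
      c₂ = proj₁ (stableTail α B x₀)

      upper : ∃[ c ] L ⊢ c₁ ≤ c × L ⊢ c₂ ≤ c
      upper = [ (λ c₁≤c₂ → c₂ , c₁≤c₂ , L.≤-refl) , (λ c₂≤c₁ → c₁ , L.≤-refl , c₂≤c₁) ]′
                (L.total c₁ c₂)
      c = proj₁ upper

      stable-mono : ∀ {P c′} → L ⊢ c′ ≤ c → Stable P c′ → Stable P c
      stable-mono {P} {c′} c′≤c s d = begin
        L ↾ (tail L c ∩ P)   ∼⟨ ↾-mono {L} (λ (c≤x , px) → L.≤-trans c′≤c c≤x , px) ⟩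
        L ↾ (tail L c′ ∩ P)  ∼⟨ s d ⟩
        L ↾ (tail L d ∩ P)   ∎

      stableA = stable-mono {A} (proj₁ (proj₂ upper)) (proj₂ (stableTail α A x₀))
      stableB = stable-mono {B} (proj₂ (proj₂ upper)) (proj₂ (stableTail α B x₀))

      longer : ∀ A B → (∀ x → A x ⊎ B x) → Stable A c → Stable B c →
               L ↾ (tail L c ∩ A) ⪯ L ↾ (tail L c ∩ B) → L ⪯ L ↾ A ⊎ L ⪯ L ↾ B
      longer A B cover sA sB A⪯B = inj₂ (decidable-stable em λ ¬L⪯B → ¬L⪯B (begin
        L                    ∼⟨ rightInd c ⟩
        L ↾ tail L c         ∼⟨ tail-⪯-longer α A B c cover sA sB A⪯B (indB ¬L⪯B) ⟩
        L ↾ (tail L c ∩ B)   ∼⟨ ↾-mono {L} proj₂ ⟩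
        L ↾ B                ∎))
        where
        Bᶜ = α ↾ₒ (tail L c ∩ B)
        -- Stability says that the tail of B above c embeds into its own tails.
        indB : ¬ (L ⪯ L ↾ B) → Indivisible (order Bᶜ)
        indB ¬L⪯B = go Bᶜ
          (rs (¬⪯⇒<ₒ α Bᶜ λ L⪯Bᶜ → ¬L⪯B
            (⪯-trans {L} {order Bᶜ} {L ↾ B} L⪯Bᶜ (↾-mono {L} proj₂))))
          λ b′@(b , c≤b , _) → ⪯-trans {order Bᶜ} {L ↾ (tail L b ∩ B)}
            {order Bᶜ ↾ tail (order Bᶜ) b′} (sB b)
            ((λ (x , b≤x , bx) → (x , L.≤-trans c≤b b≤x , bx) , b≤x) ,
             λ _ _ → mk⇔ id id)

  -- A tail that does not embed α would be a smaller ordinal, and α is the sum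
  -- of a proper initial segment and the corresponding tail.
  indecomposable⇒rightIndecomposable : ∀ α → Indecomposable α →
                                       RightIndecomposable (order α)
  indecomposable⇒rightIndecomposable α (_ , closed) c =
    fromInj₁ (λ T<α → ⊥-elim (<ₒ⇒¬⪰ (S +ₒ T) α
               (closed S T (initialSegment-<ₒ α c) T<α) (⪯-cut (order α) c)))
             (comparable α T)
    where
    S = initialSegmentₒ α c
    T = α ↾ₒ tail (order α) c

  indecomposable⇒indivisible : ∀ α → Indecomposable α → Indivisible (order α)
  indecomposable⇒indivisible α =
    rightIndecomposable⇒indivisible α ∘ indecomposable⇒rightIndecomposable α

-- Convex sums as chains in a product

-- A point of the sum is determined up to equality by its index in K and its
-- value in K′, and both depend monotonically on the point.
module ConvexSum {K K′ : LinearOrder} (F : ConvexFamily K K′) where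
  open ConvexFamily F
  private
    module K = Lin K
    module K′ = Lin K′

  S : LinearOrder
  S = convexSum K K′ F

  index : ∣ S ∣ → ∣ K ∣
  index ((_ , k) , _) = k

  value : ∣ S ∣ → ∣ K′ ∣
  value ((x , _) , _) = x

  index-mono : ∀ s t → S ⊢ s ≤ t → K ⊢ index s ≤ index t
  index-mono _ _ (inj₁ (i≤j , _)) = i≤j
  index-mono _ _ (inj₂ (i≈j , _)) = K.reflexive i≈j

  value-mono : ∀ s t → S ⊢ s ≤ t → K′ ⊢ value s ≤ value t
  value-mono (_ , x∈) (_ , y∈) (inj₁ i<j)       = ordered i<j x∈ y∈
  value-mono _        _        (inj₂ (_ , x≤y)) = x≤y

  sum-wellFounded : WellFounded (K ⊢_<_) → WellFounded (K′ ⊢_<_) → WellFounded (S ⊢_<_)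
  sum-wellFounded wf wf′ = Subrelation.wellFounded
    (λ { (inj₁ i<j         , _)   → inj₁ i<j
       ; (inj₂ (i≈j , x≤y) , s≉t) → inj₂ (i≈j , x≤y , λ x≈y → s≉t (i≈j , x≈y)) })
    (On.wellFounded (swap ∘ proj₁) (×-wellFounded' K.Eq.trans K.<-respʳ-≈ wf wf′))

  -- Points whose index, respectively value, is strictly smaller than that of
  -- every later point.
  IndexRises ValueRises : Pred ∣ S ∣ 0ℓ
  IndexRises s = ∀ t → S ⊢ s < t → K ⊢ index s < index t
  ValueRises s = ∀ t → S ⊢ s < t → K′ ⊢ value s < value t

  -- If the index stays constant up to some later point t, then the value
  -- strictly increases at every later point: before t because the index is
  -- still the same, and after t because the value has increased by then.
  rises : ExcludedMiddle 0ℓ → ∀ s → IndexRises s ⊎ ValueRises s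
  rises em s with em {∃[ t ] (S ⊢ s < t) × index s K.≈ index t}
  ... | no  none = inj₁ λ t s<t → index-mono s t (proj₁ s<t) , λ i≈j → none (t , s<t , i≈j)
  ... | yes (t , s<t , i≈j) = inj₂ λ u s<u →
    [ (λ t≤u → K′.<-≤-trans (sameIndex t s<t i≈j) (value-mono t u t≤u))
    , (λ u≤t → sameIndex u s<u (K.antisym (index-mono s u (proj₁ s<u))
                 (K.≤-trans (index-mono u t u≤t) (K.reflexive (K.Eq.sym i≈j)))))
    ]′ (DecTotalOrder.total S t u)
    where
    sameIndex : ∀ u → S ⊢ s < u → index s K.≈ index u → K′ ⊢ value s < value u
    sameIndex u s<u i≈j = value-mono s u (proj₁ s<u) , λ x≈y → proj₂ s<u (i≈j , x≈y)

  index-embedding : S ↾ IndexRises ⪯ K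
  index-embedding = embed {S ↾ IndexRises} {K} (index ∘ proj₁)
    (λ {s} {t} → index-mono (proj₁ s) (proj₁ t)) (λ { {_ , r} {t , _} → r t })

  value-embedding : S ↾ ValueRises ⪯ K′
  value-embedding = embed {S ↾ ValueRises} {K′} (value ∘ proj₁)
    (λ {s} {t} → value-mono (proj₁ s) (proj₁ t)) (λ { {_ , r} {t , _} → r t })

  indivisible-⪯-sum : ExcludedMiddle 0ℓ → ∀ {L} → Indivisible L →
                      L ⪯ S → L ⪯ K ⊎ L ⪯ K′
  indivisible-⪯-sum em {L} ind e = map⊎
    (λ h → ⪯-trans {L} {S ↾ IndexRises} {K} h index-embedding)
    (λ h → ⪯-trans {L} {S ↾ ValueRises} {K′} h value-embedding)
    (indivisible-⪯ {L} {S} ind e IndexRises ValueRises (rises em))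

  -- A strict bound s on the image in the sum becomes a strict bound on the
  -- image in K or K′, because the chosen coordinate increases before reaching s.
  indivisible-⪯-segment : ExcludedMiddle 0ℓ → ∀ {L} s → Indivisible L →
    L ⪯ initialSegment S s →
    L ⪯ initialSegment K (index s) ⊎ L ⪯ initialSegment K′ (value s)
  indivisible-⪯-segment em {L} s ind e = map⊎
    (λ h → ⪯-trans {L} {seg ↾ (IndexRises ∘ proj₁)} {initialSegment K (index s)} h
      (embed {seg ↾ (IndexRises ∘ proj₁)} {initialSegment K (index s)}
        (λ ((t , t<s) , r) → index t , r s t<s)
        (λ {t} {u} → index-mono (proj₁ (proj₁ t)) (proj₁ (proj₁ u)))
        (λ { {_ , r} {(t , _) , _} → r t })))
    (λ h → ⪯-trans {L} {seg ↾ (ValueRises ∘ proj₁)} {initialSegment K′ (value s)} h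
      (embed {seg ↾ (ValueRises ∘ proj₁)} {initialSegment K′ (value s)}
        (λ ((t , t<s) , r) → value t , r s t<s)
        (λ {t} {u} → value-mono (proj₁ (proj₁ t)) (proj₁ (proj₁ u)))
        (λ { {_ , r} {(t , _) , _} → r t })))
    (indivisible-⪯ {L} {seg} ind e (IndexRises ∘ proj₁) (ValueRises ∘ proj₁)
      (rises em ∘ proj₁))
    where seg = initialSegment S s

-- The convex sum over the segment below m, with the set of all x ≤ c as the
-- part of the least index and the singleton of c as every other part.
module SegmentSum (γ : Ordinal) {c m b : ∣ order γ ∣} (c<m : order γ ⊢ c < m)
                  (b-least : ∀ x → order γ ⊢ b ≤ x) where
  private
    module G = Lin (order γ)
    M = initialSegment (order γ) m

  -- The point b is the least index, so that b < k holds exactly of the others.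
  family : ConvexFamily M M
  family = record
    { part     = λ (k , _) (x , _) → x G.≤ c × (b G.< k → c G.≤ x)
    ; resp     = λ k≈k′ → (λ (x≤c , h) → x≤c , h ∘ G.<-respʳ-≈ (G.Eq.sym k≈k′))
                        , (λ (x≤c , h) → x≤c , h ∘ G.<-respʳ-≈ k≈k′)
    ; nonempty = λ _ → (c , c<m) , G.≤-refl , λ _ → G.≤-refl
    ; convex   = λ _ x≤y y≤z (_ , h) (z≤c , _) →
                   G.≤-trans y≤z z≤c , λ b<k → G.≤-trans (h b<k) x≤y
    ; ordered  = λ k₀<k₁ (x≤c , _) (_ , h) →
                   G.≤-trans x≤c (h (G.≤-<-trans (b-least _) k₀<k₁))
    }

  segments-⪯ : ⊎-<-decTotalOrder (initialSegment (order γ) c) M ⪯ convexSum M M family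
  segments-⪯ = embed {D} {S} f mono strict
    where
    D = ⊎-<-decTotalOrder (initialSegment (order γ) c) M
    S = convexSum M M family
    bₘ : ∣ M ∣
    bₘ = b , G.≤-<-trans (b-least c) c<m
    f : ∣ D ∣ → ∣ S ∣
    f (inj₁ (x , x<c)) = ((x , G.<-trans x<c c<m) , bₘ) ,
      proj₁ x<c , λ b<b → ⊥-elim (proj₂ b<b G.Eq.refl)
    f (inj₂ k) = ((c , c<m) , k) , G.≤-refl , λ _ → G.≤-refl
    mono : ∀ {x y} → D ⊢ x ≤ y → S ⊢ f x ≤ f y
    mono (₁∼₁ x≤y) = inj₂ (G.Eq.refl , x≤y)
    mono {inj₁ (x , x<c)} {inj₂ (k , _)} ₁∼₂ with b G.≟ k
    ... | yes b≈k = inj₂ (b≈k , proj₁ x<c)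
    ... | no  b≉k = inj₁ (b-least k , b≉k)
    mono {inj₂ (k , _)} {inj₂ (k′ , _)} (₂∼₂ k≤k′) with k G.≟ k′
    ... | yes k≈k′ = inj₂ (k≈k′ , G.≤-refl)
    ... | no  k≉k′ = inj₁ (k≤k′ , k≉k′)
    apart : ∀ {x y} → D ⊢ x ≤ y →
            DecTotalOrder._≈_ S (f x) (f y) → DecTotalOrder._≈_ D x y
    apart (₁∼₁ _)                 (_ , x≈y) = Pointwise.inj₁ x≈y
    apart {inj₁ (_ , x<c)} ₁∼₂    (_ , x≈c) = contradiction x≈c (proj₂ x<c)
    apart (₂∼₂ _)                 (k≈k′ , _) = Pointwise.inj₂ k≈k′
    strict : ∀ {x y} → D ⊢ x < y → S ⊢ f x < f y
    strict (x≤y , x≉y) = mono x≤y , x≉y ∘ apart x≤y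

-- The characterisation

infinite⇒inhabited : ExcludedMiddle 0ℓ → ∀ {L} → Infinite L → ∣ L ∣
infinite⇒inhabited em {L} infinite = decidable-stable em λ empty → infinite (0 , record
  { to        = λ x → ⊥-elim (empty x)
  ; cong      = λ {x} _ → ⊥-elim (empty x)
  ; bijective = (λ {x} _ → ⊥-elim (empty x)) , λ ()
  })

infinite⇒¬singleton : ∀ {L} → Infinite L → (m : ∣ L ∣) →
                      ¬ (∀ x → DecTotalOrder._≈_ L x m)
infinite⇒¬singleton {L} infinite m all≈m = infinite (1 , record
  { to        = λ _ → zero
  ; cong      = λ _ → refl
  ; bijective = (λ {x} {y} _ → L.Eq.trans (all≈m x) (L.Eq.sym (all≈m y)))
              , λ { zero → m , λ _ → refl }
  })
  where module L = Lin L

module Characterisation (em : ExcludedMiddle 0ℓ) (γ : Ordinal) where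
  open Comparability em
  open Indivisibility em
  open ⪯-Reasoning
  private
    Γ = order γ
    module G = Lin Γ

  𝓛≺-downwardClosed : ∀ {L L′} → ∣ L ∣ → L ⪯ L′ → 𝓛≺ Γ L′ → 𝓛≺ Γ L
  𝓛≺-downwardClosed {L} {L′} x L⪯L′ (_ , L′⪯Γ , Γ⋠L′) =
    x , ⪯-trans {L} {L′} {Γ} L⪯L′ L′⪯Γ , λ Γ⪯L → Γ⋠L′ (⪯-trans {Γ} {L} {L′} Γ⪯L L⪯L′)

  -- The sum of a family of parts of a well-order, indexed by a well-order, is
  -- itself a well-order.  It is shorter than γ as soon as γ does not embed.
  ccs-criterion : (∀ {K K′} (F : ConvexFamily K K′) → Γ ⪯ convexSum K K′ F →
                   Γ ⪯ K ⊎ Γ ⪯ K′) → CCS (𝓛≺ Γ)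
  ccs-criterion reflects = record
    { downwardClosed = λ {L} {L′} → 𝓛≺-downwardClosed {L} {L′}
    ; sumClosed      = sumClosed
    }
    where
    sumClosed : ∀ {K K′} → 𝓛≺ Γ K → 𝓛≺ Γ K′ → (F : ConvexFamily K K′) →
                𝓛≺ Γ (convexSum K K′ F)
    sumClosed {K} {K′} (k , K⪯Γ , Γ⋠K) (_ , K′⪯Γ , Γ⋠K′) F =
      (let (x , x∈) = ConvexFamily.nonempty F k in (x , k) , x∈) ,
      <ₒ⇒⪯ S γ (¬⪯⇒<ₒ γ S Γ⋠S) , Γ⋠S
      where
      Γ⋠S : ¬ (Γ ⪯ convexSum K K′ F)
      Γ⋠S Γ⪯S = [ Γ⋠K , Γ⋠K′ ]′ (reflects F Γ⪯S)
      S : Ordinal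
      S = record
        { order       = convexSum K K′ F
        ; wellFounded = ConvexSum.sum-wellFounded F
            (⪯-wellFounded {K} {Γ} K⪯Γ (Ordinal.wellFounded γ))
            (⪯-wellFounded {K′} {Γ} K′⪯Γ (Ordinal.wellFounded γ))
        }

  indecomposable⇒ccs : Indecomposable γ → CCS (𝓛≺ Γ)
  indecomposable⇒ccs ind = ccs-criterion λ F →
    ConvexSum.indivisible-⪯-sum F em {Γ} (indecomposable⇒indivisible γ ind)

  successor⇒ccs : ∀ δ → Indecomposable δ → IsSuccessorOf γ δ → CCS (𝓛≺ Γ)
  successor⇒ccs δ ind γ≅δ+1 = ccs-criterion λ {K} {K′} F Γ⪯S →
    let S = convexSum K K′ F
        (s , δ⪯S) = successor-⪯⁻¹ δ {S}
          (⪯-trans {Δ} {Γ} {S} (≅⇒⪰ {Γ} {Δ} γ≅δ+1) Γ⪯S)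
    in map⊎ (extend K (index F s)) (extend K′ (value F s))
         (indivisible-⪯-segment F em {order δ} s
         (indecomposable⇒indivisible δ ind) δ⪯S)
    where
    open ConvexSum
    Δ = order (δ +ₒ 1ₒ)
    -- The point c receives the top of γ.
    extend : ∀ L c → order δ ⪯ initialSegment L c → Γ ⪯ L
    extend L c δ⪯ = ⪯-trans {Γ} {Δ} {L} (≅⇒⪯ {Γ} {Δ} γ≅δ+1) (successor-⪯ δ {L} {c} δ⪯)

  module _ (ccs : CCS (𝓛≺ Γ)) (infinite : Infinite Γ) where

    Γ⋠segments : ∀ {c m} → Γ ⊢ c < m →
      ¬ (Γ ⪯ ⊎-<-decTotalOrder (initialSegment Γ c) (initialSegment Γ m))
    Γ⋠segments {c} {m} c<m Γ⪯ = proj₂ (proj₂ (CCS.sumClosed ccs {M} {M} M∈ M∈ family))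
      (⪯-trans {Γ} {⊎-<-decTotalOrder (initialSegment Γ c) M} {convexSum M M family}
        Γ⪯ segments-⪯)
      where
      bottom = least γ (λ _ → ∣ Γ ∣) (c , c)
      open SegmentSum γ c<m (λ x → proj₂ (proj₂ bottom) x x)
      M = initialSegment Γ m
      M∈ : 𝓛≺ Γ M
      M∈ = (c , c<m) , ↾-⪯ {Γ} , ¬⪯-initialSegment γ m

    unbounded⇒indecomposable : ¬ (∃[ m ] ∀ x → Γ ⊢ x ≤ m) → Indecomposable γ
    unbounded⇒indecomposable noMax = infinite⇒inhabited em {Γ} infinite , closed
      where
      above : ∀ m → ∃[ x ] Γ ⊢ m < x
      above m = decidable-stable em λ none →
        noMax (m , λ x → G.≮⇒≥ λ m<x → none (x , m<x))
      closed : ∀ α β → α <ₒ γ → β <ₒ γ → α +ₒ β <ₒ γ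
      closed α β (c , α≅) (d , β≅) = ¬⪯⇒<ₒ γ (α +ₒ β) λ Γ⪯α+β →
        Γ⋠segments c<m (begin
          Γ                                        ∼⟨ Γ⪯α+β ⟩
          order (α +ₒ β)
            ∼⟨ +-initialSegment {order α} {initialSegment Γ c} {order β} {M} {d′}
                 (≅⇒⪯ {order α} {initialSegment Γ c} α≅) β⪯ ⟩
          initialSegment segments (inj₂ d′)        ∼⟨ ↾-⪯ {segments} ⟩
          segments                                 ∎)
        where
        bound : ∃[ m ] (Γ ⊢ c < m) × (Γ ⊢ d < m)
        bound = [ (λ c≤d → let (m , d<m) = above d in m , G.≤-<-trans c≤d d<m , d<m)
                , (λ d≤c → let (m , c<m) = above c in m , c<m , G.≤-<-trans d≤c c<m)
                ]′ (G.total c d)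
        m = proj₁ bound
        c<m = proj₁ (proj₂ bound)
        d<m = proj₂ (proj₂ bound)
        M = initialSegment Γ m
        segments = ⊎-<-decTotalOrder (initialSegment Γ c) M
        d′ : ∣ M ∣
        d′ = d , d<m
        β⪯ : order β ⪯ initialSegment M d′
        β⪯ = begin
          order β              ∼⟨ ≅⇒⪯ {order β} {initialSegment Γ d} β≅ ⟩
          initialSegment Γ d   ∼⟨ (λ (x , x<d) → (x , G.<-trans x<d d<m) , x<d) ,
                                  (λ _ _ → mk⇔ id id) ⟩
          initialSegment M d′  ∎

    maximum⇒indecomposable : ∀ m → (∀ x → Γ ⊢ x ≤ m) → Indecomposable (initialSegmentₒ γ m)
    maximum⇒indecomposable m max = inhabitant , closed
      where
      δ = initialSegmentₒ γ m
      M = order δ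
      γ≅δ+1 = maximum⇒successor γ max
      inhabitant : ∣ M ∣
      inhabitant = decidable-stable em λ empty → infinite⇒¬singleton {Γ} infinite m
        λ x → decidable-stable em λ x≉m → empty (x , max x , x≉m)
      closed : ∀ α β → α <ₒ δ → β <ₒ δ → α +ₒ β <ₒ δ
      closed α β ((c , c<m) , α≅) (d , β≅) = ¬⪯⇒<ₒ δ (α +ₒ β) λ δ⪯α+β →
        Γ⋠segments c<m (begin
          Γ               ∼⟨ ≅⇒⪯ {Γ} {order (δ +ₒ 1ₒ)} γ≅δ+1 ⟩
          order (δ +ₒ 1ₒ) ∼⟨ successor-⪯ δ {segments} {inj₂ d} (begin
            M                                 ∼⟨ δ⪯α+β ⟩
            order (α +ₒ β)
              ∼⟨ +-initialSegment {order α} {initialSegment Γ c} {order β} {M} {d}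
                   α⪯ (≅⇒⪯ {order β} {initialSegment M d} β≅) ⟩
            initialSegment segments (inj₂ d)  ∎) ⟩
          segments        ∎)
        where
        segments = ⊎-<-decTotalOrder (initialSegment Γ c) M
        α⪯ : order α ⪯ initialSegment Γ c
        α⪯ = begin
          order α                     ∼⟨ ≅⇒⪯ {order α} {initialSegment M (c , c<m)} α≅ ⟩
          initialSegment M (c , c<m)  ∼⟨ (λ ((x , _) , x<c) → x , x<c) ,
                                         (λ _ _ → mk⇔ id id) ⟩
          initialSegment Γ c          ∎

    ccs⇒indecomposable : Indecomposable γ ⊎ (∃[ δ ] Indecomposable δ × IsSuccessorOf γ δ)
    ccs⇒indecomposable with em {∃[ m ] ∀ x → Γ ⊢ x ≤ m}
    ... | no  noMax     = inj₁ (unbounded⇒indecomposable noMax)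
    ... | yes (m , max) = inj₂ (initialSegmentₒ γ m , maximum⇒indecomposable m max ,
                                maximum⇒successor γ max)

proposition7p8 : ExcludedMiddle (suc 0ℓ) →
    (γ : Ordinal) → Infinite (order γ) → Countable (order γ) →
    CCS (𝓛≺ (order γ)) ⇔
    (Indecomposable γ ⊎ (∃[ δ ] Indecomposable δ × IsSuccessorOf γ δ))
proposition7p8 em γ infinite _ = mk⇔
  (λ ccs → ccs⇒indecomposable ccs infinite)
  [ indecomposable⇒ccs , (λ (δ , ind , γ≅δ+1) → successor⇒ccs δ ind γ≅δ+1) ]′
  where
  -- Only small propositions need to be decided.
  em₀ : ExcludedMiddle 0ℓ
  em₀ {P} = map′ lower lift (em {Lift (suc 0ℓ) P})
  open Characterisation em₀ γ
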